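{- Let $S\subseteq\mathbb{N}^{\mathbb{N}}$. Then $S$ is $0$th-order guessable if and only if $S\in\mathbf{\Delta}^0_2$; and for every integer $m>0$, $S$ is $m$th-order guessable if and only if $S\in\mathbf{\Delta}^0_{m+1}$.
   Context: Baire space $\mathbb{N}^{\mathbb{N}}$ carries the product of discrete topologies; $\mathbf{\Sigma}^0_n,\mathbf{\Pi}^0_n,\mathbf{\Delta}^0_n$ are the boldface Borel pointclasses. $\mathbb{N}^{<\mathbb{N}}$ is the set of finite sequences of naturals. The language $\mathscr{L}_{\max}$ is the first-order language (with equality) having: a constant symbol $\overline{n}$ for each $n\in\mathbb{N}$; an $n$-ary function symbol $\tilde w$ for each $w:\mathbb{N}^n\to\mathbb{N}$; an $n$-ary predicate symbol $\tilde p$ for each $p\subseteq\mathbb{N}^n$; a special unary function symbol $\mathbf{f}$; and, for every $n$ and every $G:\mathbb{N}^n\times\mathbb{N}^{<\mathbb{N}}\to\mathbb{N}$, an $(n+1)$-ary function symbol $G\circ\mathbf{f}$. For $f\in\mathbb{N}^{\mathbb{N}}$, $\mathscr{M}_f$ is the structure with universe $\mathbb{N}$ interpreting $\overline n$ as $n$, $\tilde w$ as $w$, $\tilde p$ as $p$, $\mathbf f$ as $f$, and $G\circ\mathbf f$ as $(m_1,\dots,m_n,m)\mapsto G(m_1,\dots,m_n,f(0),\dots,f(m))$. For a sentence $\phi$, $f(\phi)=1$ if $\mathscr{M}_f\models\phi$ and $f(\phi)=0$ otherwise. Formula classes: "quantifier-free" means containing no quantifiers at all (not even bounded ones). $\Sigma_0=\Pi_0=\Delta_0$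 is the set of quantifier-free formulas; $\Sigma_{n+1}=\{\exists x\,\phi:\phi\in\Pi_n\}$ and $\Pi_{n+1}=\{\forall x\,\phi:\phi\in\Sigma_n\}$; a formula is $\Delta_{n+1}$ if it is equivalent, in every structure $\mathscr{M}_f$ ($f\in\mathbb{N}^{\mathbb{N}}$), to some $\Sigma_{n+1}$ formula of $\mathscr{L}_{\max}$ and also to some $\Pi_{n+1}$ formula of $\mathscr{L}_{\max}$. For a set $\Sigma$ of symbols of $\mathscr{L}_{\max}$, a sentence "of $\mathscr{L}_{\max}\cap\Sigma$" is an $\mathscr{L}_{\max}$-sentence all of whose non-logical symbols lie in $\Sigma$. Definition ($m$th-order guessable): $S\subseteq\mathbb{N}^{\mathbb{N}}$ is $m$th-order guessable if there exist a countable set $\Sigma$ of $\mathscr{L}_{\max}$-symbols, a listing $\phi_0,\phi_1,\dots$ of all $\Delta_m$ sentences of $\mathscr{L}_{\max}\cap\Sigma$, and a function $G:\{0,1\}^{<\mathbb{N}}\to\mathbb{N}$ such that for every $f:\mathbb{N}\to\mathbb{N}$, $\lim_{n\to\infty}G(f(\phi_0),\dots,f(\phi_n))$ equals $1$ if $f\in S$ and $0$ if $f\notin S$. -}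

module Defs where

open import Axiom.ExcludedMiddle using (ExcludedMiddle)
open import Data.Bool.Base using (Bool)
open import Data.Fin.Base using (Fin)
open import Data.List.Base as List using (List; upTo)
open import Data.List.Relation.Unary.All using (All)
open import Data.Nat.Base using (ℕ; zero; suc; _≥_)
open import Data.Product.Base using (Σ-syntax; ∃-syntax; _×_; _,_)
open import Data.Sum.Base using (_⊎_; inj₁; inj₂)
open import Data.Vec.Base as Vec using (Vec; []; _∷_)
open import Data.Vec.Relation.Unary.All using () renaming (All to Allᵛ)
open import Function.Bundles using (_⇔_)
open import Level using (Level; 0ℓ; _⊔_) renaming (suc to lsuc)
open import Relation.Binary.PropositionalEquality.Core using (_≡_)
open import Relation.Nullary.Decidable.Core using (does)
open import Relation.Nullary.Negation.Core using (¬_)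
open import Relation.Unary using (Pred; _∈_; _∉_; ∁; ⋃; _≐_)

private
  variable
    a ℓ : Level
    k n : ℕ

1ℓ : Level
1ℓ = lsuc 0ℓ

Baire : Set
Baire = ℕ → ℕ

-- Product of discrete topologies: the sets { g | g i ≡ f i for all i in F },
-- for F a finite set of coordinates, form a neighbourhood base at f.
Open : Pred Baire 0ℓ → Set
Open U = ∀ f → f ∈ U →
  Σ[ F ∈ List ℕ ] (∀ g → All (λ i → g i ≡ f i) F → g ∈ U)

-- The classes start at index 1; index 0 is unused.
data 𝚺⁰ : ℕ → Pred (Pred Baire 0ℓ) 1ℓ
𝚷⁰ : ℕ → Pred (Pred Baire 0ℓ) 1ℓ

data 𝚺⁰ where
  isOpen  : ∀ {U} → Open U → U ∈ 𝚺⁰ 1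
  isUnion : ∀ {n U} (A : ℕ → Pred Baire 0ℓ) →
            (∀ i → A i ∈ 𝚷⁰ (suc n)) → U ≐ ⋃ ℕ A → U ∈ 𝚺⁰ (suc (suc n))

𝚷⁰ n U = ∁ U ∈ 𝚺⁰ n

𝚫⁰ : ℕ → Pred (Pred Baire 0ℓ) 1ℓ
𝚫⁰ n U = U ∈ 𝚺⁰ n × U ∈ 𝚷⁰ n

data FunctionSymbol : ℕ → Set where
  const : ℕ → FunctionSymbol 0
  fun   : (Vec ℕ n → ℕ) → FunctionSymbol n
  𝐟     : FunctionSymbol 1
  _∘𝐟   : (Vec ℕ n → List ℕ → ℕ) → FunctionSymbol (suc n)

data PredicateSymbol : ℕ → Set₁ where
  pred : Pred (Vec ℕ n) 0ℓ → PredicateSymbol n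

Symbol : Set₁
Symbol = (Σ[ n ∈ ℕ ] FunctionSymbol n) ⊎ (Σ[ n ∈ ℕ ] PredicateSymbol n)

-- Well-scoped de Bruijn syntax: k bounds the free variables, and a quantifier
-- binds variable zero of its body.
data Term (k : ℕ) : Set where
  var : Fin k → Term k
  app : FunctionSymbol n → Vec (Term k) n → Term k

infix  8 _≈̇_
infixr 7 _∧̇_
infixr 6 _∨̇_
infixr 5 _⇒̇_

data Formula (k : ℕ) : Set₁ where
  _≈̇_           : Term k → Term k → Formula k
  rel           : PredicateSymbol n → Vec (Term k) n → Formula k
  ¬̇_            : Formula k → Formula k
  _∧̇_ _∨̇_ _⇒̇_ : Formula k → Formula k → Formula k
  ∀̇_ ∃̇_        : Formula (suc k) → Formula k

Sentence : Set₁
Sentence = Formula 0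

⟦_⟧ᶠ : FunctionSymbol n → Baire → Vec ℕ n → ℕ
⟦ const c ⟧ᶠ f _  = c
⟦ fun w   ⟧ᶠ f ms = w ms
⟦ 𝐟       ⟧ᶠ f ms = f (Vec.head ms)
⟦ G ∘𝐟    ⟧ᶠ f ms = G (Vec.init ms) (List.map f (upTo (suc (Vec.last ms))))

mutual
  eval : Baire → Vec ℕ k → Term k → ℕ
  eval f ρ (var x)    = Vec.lookup ρ x
  eval f ρ (app s ts) = ⟦ s ⟧ᶠ f (evals f ρ ts)

  evals : Baire → Vec ℕ k → Vec (Term k) n → Vec ℕ n
  evals f ρ []       = []
  evals f ρ (t ∷ ts) = eval f ρ t ∷ evals f ρ ts

infix 4 ℳ_,_⊨_

ℳ_,_⊨_ : Baire → Vec ℕ k → Formula k → Set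
ℳ f , ρ ⊨ t ≈̇ u         = eval f ρ t ≡ eval f ρ u
ℳ f , ρ ⊨ rel (pred p) ts = evals f ρ ts ∈ p
ℳ f , ρ ⊨ ¬̇ φ           = ¬ (ℳ f , ρ ⊨ φ)
ℳ f , ρ ⊨ φ ∧̇ ψ         = (ℳ f , ρ ⊨ φ) × (ℳ f , ρ ⊨ ψ)
ℳ f , ρ ⊨ φ ∨̇ ψ         = (ℳ f , ρ ⊨ φ) ⊎ (ℳ f , ρ ⊨ ψ)
ℳ f , ρ ⊨ φ ⇒̇ ψ         = (ℳ f , ρ ⊨ φ) → (ℳ f , ρ ⊨ ψ)
ℳ f , ρ ⊨ ∀̇ φ           = ∀ m → ℳ f , m ∷ ρ ⊨ φ
ℳ f , ρ ⊨ ∃̇ φ           = ∃[ m ] (ℳ f , m ∷ ρ ⊨ φ)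

-- The value f(φ) ∈ {0,1}, with true for 1; it exists for all φ only
-- classically, hence the excluded-middle argument.
truthValue : ExcludedMiddle 0ℓ → Baire → Sentence → Bool
truthValue em f φ = does (em {ℳ f , [] ⊨ φ})

data QuantifierFree {k} : Pred (Formula k) 1ℓ where
  eq  : ∀ {t u} → QuantifierFree (t ≈̇ u)
  rel : ∀ {n} {p : PredicateSymbol n} {ts} → QuantifierFree (rel p ts)
  neg : ∀ {φ} → QuantifierFree φ → QuantifierFree (¬̇ φ)
  and : ∀ {φ ψ} → QuantifierFree φ → QuantifierFree ψ → QuantifierFree (φ ∧̇ ψ)
  or  : ∀ {φ ψ} → QuantifierFree φ → QuantifierFree ψ → QuantifierFree (φ ∨̇ ψ)
  imp : ∀ {φ ψ} → QuantifierFree φ → QuantifierFree ψ → QuantifierFree (φ ⇒̇ ψ)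

mutual
  data Σ-formula : ∀ {k} → ℕ → Pred (Formula k) 1ℓ where
    qf : ∀ {k} {φ : Formula k} → QuantifierFree φ → Σ-formula 0 φ
    ex : ∀ {k n} {φ : Formula (suc k)} → Π-formula n φ → Σ-formula (suc n) (∃̇ φ)

  data Π-formula : ∀ {k} → ℕ → Pred (Formula k) 1ℓ where
    qf  : ∀ {k} {φ : Formula k} → QuantifierFree φ → Π-formula 0 φ
    all : ∀ {k n} {φ : Formula (suc k)} → Σ-formula n φ → Π-formula (suc n) (∀̇ φ)

Equivalent : Formula k → Formula k → Set
Equivalent φ ψ = ∀ f ρ → (ℳ f , ρ ⊨ φ) ⇔ (ℳ f , ρ ⊨ ψ)

Δ-formula : ℕ → Pred (Formula k) 1ℓ
Δ-formula zero    φ = QuantifierFree φ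
Δ-formula (suc n) φ =
  (∃[ ψ ] (Σ-formula (suc n) ψ × Equivalent φ ψ)) ×
  (∃[ ψ ] (Π-formula (suc n) ψ × Equivalent φ ψ))

data TermOver (P : Pred Symbol ℓ) {k} : Pred (Term k) (1ℓ ⊔ ℓ) where
  var : ∀ {x} → TermOver P (var x)
  app : ∀ {n} {s : FunctionSymbol n} {ts} → inj₁ (n , s) ∈ P →
        Allᵛ (TermOver P) ts → TermOver P (app s ts)

data FormulaOver (P : Pred Symbol ℓ) : ∀ {k} → Pred (Formula k) (1ℓ ⊔ ℓ) where
  eq  : ∀ {k} {t u : Term k} →
        TermOver P t → TermOver P u → FormulaOver P (t ≈̇ u)
  rel : ∀ {k n} {p : PredicateSymbol n} {ts : Vec (Term k) n} →
        inj₂ (n , p) ∈ P → Allᵛ (TermOver P) ts → FormulaOver P (rel p ts)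
  neg : ∀ {k} {φ : Formula k} → FormulaOver P φ → FormulaOver P (¬̇ φ)
  and : ∀ {k} {φ ψ : Formula k} →
        FormulaOver P φ → FormulaOver P ψ → FormulaOver P (φ ∧̇ ψ)
  or  : ∀ {k} {φ ψ : Formula k} →
        FormulaOver P φ → FormulaOver P ψ → FormulaOver P (φ ∨̇ ψ)
  imp : ∀ {k} {φ ψ : Formula k} →
        FormulaOver P φ → FormulaOver P ψ → FormulaOver P (φ ⇒̇ ψ)
  all : ∀ {k} {φ : Formula (suc k)} → FormulaOver P φ → FormulaOver P (∀̇ φ)
  ex  : ∀ {k} {φ : Formula (suc k)} → FormulaOver P φ → FormulaOver P (∃̇ φ)

-- Finite or countably infinite: some map to ℕ is injective on P.
Countable : {A : Set a} → Pred A ℓ → Set (a ⊔ ℓ)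
Countable {A = A} P =
  Σ[ c ∈ (A → ℕ) ] (∀ {x y} → x ∈ P → y ∈ P → c x ≡ c y → x ≡ y)

-- Repetitions are allowed.
_Lists_ : {A : Set a} → (ℕ → A) → Pred A ℓ → Set (a ⊔ ℓ)
φ Lists P = (∀ n → φ n ∈ P) × (∀ x → x ∈ P → ∃[ n ] φ n ≡ x)

-- Convergence in the discrete space ℕ.
_ConvergesTo_ : (ℕ → ℕ) → ℕ → Set
s ConvergesTo l = ∃[ N ] (∀ n → n ≥ N → s n ≡ l)

Guessable : ExcludedMiddle 0ℓ → ℕ → Pred Baire 0ℓ → Set (lsuc 1ℓ)
Guessable em m S =
  Σ[ P ∈ Pred Symbol 1ℓ ] Countable P ×
  (Σ[ φ ∈ (ℕ → Sentence) ]
    φ Lists (λ ψ → Δ-formula m ψ × FormulaOver P ψ) ×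
    (Σ[ G ∈ (List Bool → ℕ) ] (∀ f →
      let guess = λ n → G (List.map (λ i → truthValue em f (φ i)) (upTo (suc n)))
      in (f ∈ S → guess ConvergesTo 1) × (f ∉ S → guess ConvergesTo 0))))

{-# OPTIONS --safe #-}
module Submission where

-- A guess is decided by the truth values of finitely many Δ_m sentences, so
-- "the guesses converge to v" is a countable union of countable intersections
-- of 𝚫⁰ sets of level max(m,1); this puts S and its complement in the next 𝚺⁰.
-- Conversely write S = ⋃ Aᵢ and its complement as ⋃ Bᵢ with all Aᵢ, Bᵢ one
-- level lower in 𝚷⁰. The complement of each Aᵢ and Bᵢ is a countable union of
-- sets defined by Δ_m sentences (a symbol G ∘ 𝐟 tests whether a cylinder lies in
-- an open set, and each further union or complement costs one quantifier), so
-- if f lies outside such a set, some true sentence eventually refutes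
-- f's membership in it. Guess "in S" when the first set not yet refuted among
-- A₀, B₀, A₁, B₁, … is one of the Aᵢ.

open import Defs
open import Axiom.ExcludedMiddle using (ExcludedMiddle)
open import Data.Bool.Base using (Bool; true; false; if_then_else_)
open import Data.Fin.Base using (Fin; zero; suc; toℕ; fromℕ<)
open import Data.Fin.Properties using (toℕ<n; fromℕ<-toℕ)
open import Data.List.Base as List using (List; []; _∷_; _++_; upTo; applyUpTo)
open import Data.List.Membership.Propositional using () renaming (_∈_ to _∈ˡ_)
open import Data.List.Membership.Propositional.Properties using (∈-++⁺ˡ; ∈-++⁺ʳ)
open import Data.List.Properties using (map-upTo; map-cong-local; ∷-injectiveˡ; ∷-injectiveʳ)
open import Data.List.Relation.Unary.All as All using (All; []; _∷_)
open import Data.List.Relation.Unary.All.Properties using (++⁻ˡ; ++⁻ʳ)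
open import Data.List.Relation.Unary.Any using (here; there)
open import Data.Nat.Base using (ℕ; zero; suc; _+_; _≤_; _<_; _≥_; _>_; _⊔_; s≤s)
open import Data.Nat.Properties using (_<?_; ≤-trans; m≤m⊔n; m≤n⊔m; m≤n⇒m<n∨m≡n; ≤-<-connex; +-suc; suc-injective; +-identityʳ)
open import Data.Product.Base using (Σ-syntax; ∃-syntax; _×_; _,_; proj₁; proj₂; map₁; map₂)
open import Data.Product.Function.NonDependent.Propositional using (_×-⇔_)
open import Data.Product.Properties using (,-injectiveˡ; ,-injectiveʳ)
open import Data.Sum.Base using (_⊎_; inj₁; inj₂)
open import Data.Sum.Function.Propositional using (_⊎-⇔_)
open import Data.Vec.Base as Vec using (Vec; []; _∷_; _∷ʳ_)
open import Data.Vec.Properties using (init-∷ʳ; last-∷ʳ; map-∷ʳ; tabulate-∘; tabulate∘lookup)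
open import Data.Vec.Relation.Unary.All using ([]; _∷_) renaming (All to Allᵛ)
open import Function.Base using (_∘_; id)
open import Function.Bundles using (_⇔_; mk⇔; Equivalence)
open import Function.Related.TypeIsomorphisms using (→-cong-⇔; ¬-cong-⇔)
open import Level using (Level; 0ℓ)
open import Relation.Binary.PropositionalEquality
open import Relation.Nullary.Decidable using (yes; no; does; dec-true; dec-false; decidable-stable)
open import Relation.Nullary.Negation using (¬_; contradiction)
open import Relation.Unary using (Pred; _∈_; _∉_; ∁; ⋃; _∩_; _∪_; _≐_)

private
  variable
    a ℓ : Level
    A : Set a
    k n : ℕ

open Equivalence using (to; from)

-- Pairing and initial segments

-- Walks along the antidiagonals of ℕ × ℕ.
unpair : ℕ → ℕ × ℕ
unpair zero    = 0 , 0
unpair (suc n) with unpair n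
... | a , zero  = zero , suc a
... | a , suc b = suc a , b

unpair-surjective : ∀ a b → ∃[ n ] unpair n ≡ (a , b)
unpair-surjective a b = go (a + b) a b refl
  where
  -- Recursion on the diagonal `s`, then on `a`: `(suc a , b)` follows `(a , suc b)`, and
  -- `(zero , suc b)` follows `(b , zero)`, the end of the previous diagonal.
  go : ∀ s a b → a + b ≡ s → ∃[ n ] unpair n ≡ (a , b)
  go s zero zero _ = 0 , refl
  go (suc s) zero (suc b) e
    with n , p ← go s b zero (trans (+-identityʳ b) (suc-injective e)) =
    suc n , next
    where
    next : unpair (suc n) ≡ (zero , suc b)
    next rewrite p = refl
  go s (suc a) b e with n , p ← go s a (suc b) (trans (+-suc a b) e) =
    suc n , next
    where
    next : unpair (suc n) ≡ (suc a , b)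
    next rewrite p = refl

pair : ℕ → ℕ → ℕ
pair a b = proj₁ (unpair-surjective a b)

unpair-pair : ∀ a b → unpair (pair a b) ≡ (a , b)
unpair-pair a b = proj₂ (unpair-surjective a b)

pair-injective : ∀ a b c d → pair a b ≡ pair c d → (a , b) ≡ (c , d)
pair-injective a b c d e =
  trans (sym (unpair-pair a b)) (trans (cong unpair e) (unpair-pair c d))

infix 9 _↾_

-- Entries `0` to `n` inclusive: the list that `G ∘𝐟` receives for last argument `n`.
_↾_ : (ℕ → A) → ℕ → List A
h ↾ n = List.map h (upTo (suc n))

applyUpTo-agree : ∀ (g h : ℕ → A) i j → applyUpTo g i ≡ applyUpTo h j →
  ∀ {a} → a < j → g a ≡ h a
applyUpTo-agree g h (suc i) (suc j) e {zero}  _       = ∷-injectiveˡ e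
applyUpTo-agree g h (suc i) (suc j) e {suc a} (s≤s p) =
  applyUpTo-agree (g ∘ suc) (h ∘ suc) i j (∷-injectiveʳ e) p

↾-agree : ∀ {g h : ℕ → A} {i j a} → g ↾ i ≡ h ↾ j → a ≤ j → g a ≡ h a
↾-agree {g = g} {h} {i} {j} e a≤j = applyUpTo-agree g h (suc i) (suc j)
  (trans (sym (map-upTo g (suc i))) (trans e (map-upTo h (suc j)))) (s≤s a≤j)

upperBound : (F : List ℕ) → ∃[ j ] All (_≤ j) F
upperBound []      = 0 , []
upperBound (x ∷ F) with j , p ← upperBound F =
  x ⊔ j , m≤m⊔n x j ∷ All.map (λ q → ≤-trans q (m≤n⊔m x j)) p

-- Continuity of terms and quantifier-free formulas

_AgreesWith_On_ : Baire → Baire → List ℕ → Set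
g AgreesWith f On F = All (λ i → g i ≡ f i) F

symbol-continuous : ∀ (s : FunctionSymbol n) f ms →
  Σ[ F ∈ List ℕ ] (∀ g → g AgreesWith f On F → ⟦ s ⟧ᶠ g ms ≡ ⟦ s ⟧ᶠ f ms)
symbol-continuous (const c) f ms = [] , λ _ _ → refl
symbol-continuous (fun w)   f ms = [] , λ _ _ → refl
symbol-continuous 𝐟         f ms = Vec.head ms ∷ [] , λ { _ (e ∷ []) → e }
symbol-continuous (G ∘𝐟)    f ms = upTo (suc (Vec.last ms)) ,
  λ _ e → cong (G (Vec.init ms)) (map-cong-local e)

mutual
  eval-continuous : ∀ f ρ (t : Term k) →
    Σ[ F ∈ List ℕ ] (∀ g → g AgreesWith f On F → eval g ρ t ≡ eval f ρ t)
  eval-continuous f ρ (var x)    = [] , λ _ _ → refl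
  eval-continuous f ρ (app s ts)
    with F , p ← evals-continuous f ρ ts
       | F′ , q ← symbol-continuous s f (evals f ρ ts) =
    F ++ F′ , λ g e → trans (cong (⟦ s ⟧ᶠ g) (p g (++⁻ˡ F e))) (q g (++⁻ʳ F e))

  evals-continuous : ∀ f ρ (ts : Vec (Term k) n) →
    Σ[ F ∈ List ℕ ] (∀ g → g AgreesWith f On F → evals g ρ ts ≡ evals f ρ ts)
  evals-continuous f ρ []       = [] , λ _ _ → refl
  evals-continuous f ρ (t ∷ ts)
    with F , p ← eval-continuous f ρ t | F′ , q ← evals-continuous f ρ ts =
    F ++ F′ , λ g e → cong₂ _∷_ (p g (++⁻ˡ F e)) (q g (++⁻ʳ F e))

≡⇒⇔ : {A B : Set a} → A ≡ B → A ⇔ B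
≡⇒⇔ refl = mk⇔ id id

-- An equivalence, not one implication, because `¬̇_` and `_⇒̇_` reverse direction.
qf-continuous : ∀ {φ : Formula k} → QuantifierFree φ → ∀ f ρ →
  Σ[ F ∈ List ℕ ] (∀ g → g AgreesWith f On F → (ℳ g , ρ ⊨ φ) ⇔ (ℳ f , ρ ⊨ φ))
qf-continuous (eq {t} {u}) f ρ
  with F , p ← eval-continuous f ρ t | F′ , q ← eval-continuous f ρ u =
  F ++ F′ , λ g e → ≡⇒⇔ (cong₂ _≡_ (p g (++⁻ˡ F e)) (q g (++⁻ʳ F e)))
qf-continuous (rel {p = pred P} {ts}) f ρ with F , p ← evals-continuous f ρ ts =
  F , λ g e → ≡⇒⇔ (cong P (p g e))
qf-continuous (neg q) f ρ with F , p ← qf-continuous q f ρ =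
  F , λ g e → ¬-cong-⇔ (p g e)
qf-continuous (and q q′) f ρ
  with F , p ← qf-continuous q f ρ | F′ , p′ ← qf-continuous q′ f ρ =
  F ++ F′ , λ g e → p g (++⁻ˡ F e) ×-⇔ p′ g (++⁻ʳ F e)
qf-continuous (or q q′) f ρ
  with F , p ← qf-continuous q f ρ | F′ , p′ ← qf-continuous q′ f ρ =
  F ++ F′ , λ g e → p g (++⁻ˡ F e) ⊎-⇔ p′ g (++⁻ʳ F e)
qf-continuous (imp q q′) f ρ
  with F , p ← qf-continuous q f ρ | F′ , p′ ← qf-continuous q′ f ρ =
  F ++ F′ , λ g e → →-cong-⇔ (p g (++⁻ˡ F e)) (p′ g (++⁻ʳ F e))

Models : Vec ℕ k → Formula k → Pred Baire 0ℓ
Models ρ φ f = ℳ f , ρ ⊨ φ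

Models-open : ∀ {φ : Formula k} ρ → QuantifierFree φ → Open (Models ρ φ)
Models-open ρ q f f⊨φ = map₂ (λ p g e → from (p g e) f⊨φ) (qf-continuous q f ρ)

-- The Borel hierarchy

𝚺-resp-≐ : ∀ {U V} → U ≐ V → U ∈ 𝚺⁰ n → V ∈ 𝚺⁰ n
𝚺-resp-≐ (U⊆V , V⊆U) (isOpen o) =
  isOpen λ f f∈V → map₂ (λ p g e → U⊆V (p g e)) (o f (V⊆U f∈V))
𝚺-resp-≐ (U⊆V , V⊆U) (isUnion A π (i , j)) =
  isUnion A π ((λ v → i (V⊆U v)) , λ w → U⊆V (j w))

𝚺₁⇒Open : ∀ {U} → U ∈ 𝚺⁰ 1 → Open U
𝚺₁⇒Open (isOpen o) = o

𝚺⇒⋃ : ∀ {U} → U ∈ 𝚺⁰ (suc (suc n)) →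
  Σ[ A ∈ (ℕ → Pred Baire 0ℓ) ] (∀ i → A i ∈ 𝚷⁰ (suc n)) × U ≐ ⋃ ℕ A
𝚺⇒⋃ (isUnion A π e) = A , π , e

𝚺-⋃ : ∀ n {A : ℕ → Pred Baire 0ℓ} →
  (∀ i → A i ∈ 𝚺⁰ (suc n)) → ⋃ ℕ A ∈ 𝚺⁰ (suc n)
𝚺-⋃ zero    σ = isOpen λ { f (i , f∈A) →
  map₂ (λ p g e → i , p g e) (𝚺₁⇒Open (σ i) f f∈A) }
-- Each `A i` is itself a union, so the double union is reindexed along `unpair`.
𝚺-⋃ (suc n) {A} σ = isUnion (λ p → C (unpair p)) (λ p → proj₁ (proj₂ (𝚺⇒⋃ (σ _))) _)
  ( (λ { (i , f∈A) → let j , f∈C = proj₁ (proj₂ (proj₂ (𝚺⇒⋃ (σ i)))) f∈A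
                     in pair i j , subst (λ p → _ ∈ C p) (sym (unpair-pair i j)) f∈C })
  , λ { (p , f∈C) → proj₁ (unpair p) ,
          proj₂ (proj₂ (proj₂ (𝚺⇒⋃ (σ _)))) (proj₂ (unpair p) , f∈C) })
  where
  C : ℕ × ℕ → Pred Baire 0ℓ
  C (i , j) = proj₁ (𝚺⇒⋃ (σ i)) j

𝚺-∪ : ∀ n {U V} → U ∈ 𝚺⁰ (suc n) → V ∈ 𝚺⁰ (suc n) → U ∪ V ∈ 𝚺⁰ (suc n)
𝚺-∪ n {U} {V} σ τ = 𝚺-resp-≐
  ( (λ { (zero , u) → inj₁ u ; (suc _ , v) → inj₂ v })
  , λ { (inj₁ u) → 0 , u ; (inj₂ v) → 1 , v })
  (𝚺-⋃ n {λ { zero → U ; (suc _) → V }} λ { zero → σ ; (suc _) → τ })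

-- Taking an arbitrary `K` lets the induction pass to `¬ K` without ever deciding `K`.
𝚺-const : ∀ n (K : Set) → (λ _ → K) ∈ 𝚺⁰ (suc n)
𝚺-const zero    K = isOpen λ f x → [] , λ _ _ → x
𝚺-const (suc n) K = isUnion (λ _ _ → K) (λ _ → 𝚺-const n (¬ K))
  ((λ x → 0 , x) , proj₂)

𝚷⇒𝚺-suc : ∀ n {U} → U ∈ 𝚷⁰ (suc n) → U ∈ 𝚺⁰ (suc (suc n))
𝚷⇒𝚺-suc n {U} π = isUnion (λ _ → U) (λ _ → π) ((λ x → 0 , x) , proj₂)

Interior : Pred Baire 0ℓ → List ℕ → Set
Interior U σ = ∀ g j → g ↾ j ≡ σ → g ∈ U

Open⇒Interior : ∀ {U} → Open U → ∀ f → f ∈ U → ∃[ j ] Interior U (f ↾ j)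
Open⇒Interior o f f∈U with F , p ← o f f∈U with j , F≤j ← upperBound F =
  j , λ g i e → p g (All.map (↾-agree e) F≤j)

↾-open : ∀ (Q : Pred (List ℕ) 0ℓ) j → Open (λ f → Q (f ↾ j))
↾-open Q j f q = upTo (suc j) , λ g e → subst Q (sym (map-cong-local e)) q

-- An open set is the union over `j` of clopen sets, the `j`-th asking that the cylinder of the
-- first `suc j` values lie in `U`. Above level one the same pieces serve, raised inductively.
𝚺-suc : ∀ n {U} → U ∈ 𝚺⁰ (suc n) → U ∈ 𝚺⁰ (suc (suc n))
𝚺-suc zero {U} (isOpen o) = isUnion (λ j f → Interior U (f ↾ j))
  (λ j → isOpen (↾-open (λ σ → ¬ Interior U σ) j))
  ((λ {f} → Open⇒Interior o f) , λ { {f} (j , i) → i f j refl })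
𝚺-suc (suc n) (isUnion A π e) = isUnion A (λ i → 𝚺-suc n (π i)) e

-- Symbols of a formula, and formulas as labelled binary trees

mutual
  termSymbols : Term k → List Symbol
  termSymbols (var x)            = []
  termSymbols (app {n = n} s ts) = inj₁ (n , s) ∷ termsSymbols ts

  termsSymbols : Vec (Term k) n → List Symbol
  termsSymbols []       = []
  termsSymbols (t ∷ ts) = termSymbols t ++ termsSymbols ts

symbols : Formula k → List Symbol
symbols (t ≈̇ u)            = termSymbols t ++ termSymbols u
symbols (rel {n = n} p ts) = inj₂ (n , p) ∷ termsSymbols ts
symbols (¬̇ φ)              = symbols φ
symbols (φ ∧̇ ψ)            = symbols φ ++ symbols ψ
symbols (φ ∨̇ ψ)            = symbols φ ++ symbols ψ
symbols (φ ⇒̇ ψ)            = symbols φ ++ symbols ψ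
symbols (∀̇ φ)              = symbols φ
symbols (∃̇ φ)              = symbols φ

module _ {P : Pred Symbol ℓ} where
  mutual
    termOver : (t : Term k) → (∀ {s} → s ∈ˡ termSymbols t → P s) → TermOver P t
    termOver (var x)    h = var
    termOver (app s ts) h = app (h (here refl)) (termsOver ts (h ∘ there))

    termsOver : (ts : Vec (Term k) n) → (∀ {s} → s ∈ˡ termsSymbols ts → P s) →
      Allᵛ (TermOver P) ts
    termsOver []       h = []
    termsOver (t ∷ ts) h =
      termOver t (h ∘ ∈-++⁺ˡ) ∷ termsOver ts (h ∘ ∈-++⁺ʳ (termSymbols t))

  formulaOver : (φ : Formula k) → (∀ {s} → s ∈ˡ symbols φ → P s) → FormulaOver P φ
  formulaOver (t ≈̇ u)    h =
    eq (termOver t (h ∘ ∈-++⁺ˡ)) (termOver u (h ∘ ∈-++⁺ʳ (termSymbols t)))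
  formulaOver (rel p ts) h = rel (h (here refl)) (termsOver ts (h ∘ there))
  formulaOver (¬̇ φ)      h = neg (formulaOver φ h)
  formulaOver (φ ∧̇ ψ)    h =
    and (formulaOver φ (h ∘ ∈-++⁺ˡ)) (formulaOver ψ (h ∘ ∈-++⁺ʳ (symbols φ)))
  formulaOver (φ ∨̇ ψ)    h =
    or (formulaOver φ (h ∘ ∈-++⁺ˡ)) (formulaOver ψ (h ∘ ∈-++⁺ʳ (symbols φ)))
  formulaOver (φ ⇒̇ ψ)    h =
    imp (formulaOver φ (h ∘ ∈-++⁺ˡ)) (formulaOver ψ (h ∘ ∈-++⁺ʳ (symbols φ)))
  formulaOver (∀̇ φ)      h = all (formulaOver φ h)
  formulaOver (∃̇ φ)      h = ex (formulaOver φ h)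

-- One untyped shape codes terms, argument lists and formulas alike: a label serves as a variable
-- index, a symbol index or a connective tag.
data Tree : Set where
  leaf : ℕ → Tree
  node : ℕ → Tree → Tree → Tree

encode : Tree → ℕ
encode (leaf i)     = pair 0 i
encode (node i l r) = pair (suc i) (pair (encode l) (encode r))

encode-injective : ∀ t u → encode t ≡ encode u → t ≡ u
encode-injective (leaf i) (leaf j) e =
  cong leaf (,-injectiveʳ (pair-injective 0 i 0 j e))
encode-injective (leaf i) (node j l r) e
  with () ← ,-injectiveˡ (pair-injective 0 i (suc j) _ e)
encode-injective (node i l r) (leaf j) e
  with () ← ,-injectiveˡ (pair-injective (suc i) _ 0 j e)
encode-injective (node i l r) (node j l′ r′) e
  with e′ ← pair-injective (suc i) _ (suc j) _ e
  with e″ ← pair-injective (encode l) (encode r) (encode l′) (encode r′) (,-injectiveʳ e′)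
  with refl ← ,-injectiveˡ e′
     | refl ← encode-injective l l′ (,-injectiveˡ e″)
     | refl ← encode-injective r r′ (,-injectiveʳ e″) = refl

numeral : ℕ → Term k
numeral c = app (const c) []

-- Ill-formed trees decode to arbitrary expressions, possibly using symbols
-- outside the range of e.
module Decoding (e : ℕ → Symbol) where

  varAt : ∀ k → ℕ → Term k
  varAt k i with i <? k
  ... | yes i<k = var (fromℕ< i<k)
  ... | no  _   = numeral 0

  -- The arity is known only once the symbol is inspected, so arguments are supplied at every arity.
  applyFun : Symbol → (∀ n → Vec (Term k) n) → Term k
  applyFun (inj₁ (n , s)) ts = app s (ts n)
  applyFun (inj₂ _)       ts = numeral 0

  applyRel : Symbol → (∀ n → Vec (Term k) n) → Formula k
  applyRel (inj₁ _)       ts = numeral 0 ≈̇ numeral 0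
  applyRel (inj₂ (n , p)) ts = rel p (ts n)

  mutual
    term : Tree → Term k
    term (leaf i)     = varAt _ i
    term (node i l r) = applyFun (e i) (λ n → terms n r)

    terms : ∀ n → Tree → Vec (Term k) n
    terms zero    _            = []
    terms (suc n) (leaf _)     = Vec.replicate _ (numeral 0)
    terms (suc n) (node _ l r) = term l ∷ terms n r

  formula : Tree → Formula k
  formula (node 0 l        r) = term l ≈̇ term r
  formula (node 1 (leaf i) r) = applyRel (e i) (λ n → terms n r)
  formula (node 2 l        r) = ¬̇ formula l
  formula (node 3 l        r) = formula l ∧̇ formula r
  formula (node 4 l        r) = formula l ∨̇ formula r
  formula (node 5 l        r) = formula l ⇒̇ formula r
  formula (node 6 l        r) = ∀̇ formula l
  formula (node 7 l        r) = ∃̇ formula l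
  formula _                   = numeral 0 ≈̇ numeral 0

  Range : Pred Symbol _
  Range s = ∃[ i ] e i ≡ s

  varAt-toℕ : (x : Fin k) → varAt k (toℕ x) ≡ var x
  varAt-toℕ {k} x with toℕ x <? k
  ... | yes p = cong var (fromℕ<-toℕ x p)
  ... | no ¬p = contradiction (toℕ<n x) ¬p

  mutual
    term-surjective : ∀ {t : Term k} → TermOver Range t → ∃[ c ] term c ≡ t
    term-surjective (var {x}) = leaf (toℕ x) , varAt-toℕ x
    term-surjective (app {s = s} (i , p) os) with c , q ← terms-surjective os =
      node i (leaf 0) c ,
      trans (cong (λ s → applyFun s (λ n → terms n c)) p) (cong (app s) q)

    terms-surjective : ∀ {ts : Vec (Term k) n} → Allᵛ (TermOver Range) ts →
      ∃[ c ] terms n c ≡ ts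
    terms-surjective []       = leaf 0 , refl
    terms-surjective (o ∷ os)
      with c , p ← term-surjective o | d , q ← terms-surjective os =
      node 0 c d , cong₂ _∷_ p q

  formula-surjective : ∀ {φ : Formula k} → FormulaOver Range φ →
    ∃[ c ] formula c ≡ φ
  formula-surjective (eq o o′)
    with c , p ← term-surjective o | d , q ← term-surjective o′ =
    node 0 c d , cong₂ _≈̇_ p q
  formula-surjective (rel {p = p} (i , q) os) with c , r ← terms-surjective os =
    node 1 (leaf i) c ,
    trans (cong (λ s → applyRel s (λ n → terms n c)) q) (cong (rel p) r)
  formula-surjective (neg o) with c , p ← formula-surjective o =
    node 2 c c , cong ¬̇_ p
  formula-surjective (and o o′)
    with c , p ← formula-surjective o | d , q ← formula-surjective o′ =
    node 3 c d , cong₂ _∧̇_ p q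
  formula-surjective (or o o′)
    with c , p ← formula-surjective o | d , q ← formula-surjective o′ =
    node 4 c d , cong₂ _∨̇_ p q
  formula-surjective (imp o o′)
    with c , p ← formula-surjective o | d , q ← formula-surjective o′ =
    node 5 c d , cong₂ _⇒̇_ p q
  formula-surjective (all o) with c , p ← formula-surjective o =
    node 6 c c , cong ∀̇_ p
  formula-surjective (ex o) with c , p ← formula-surjective o =
    node 7 c c , cong ∃̇_ p

-- List lookup, rotated variables and limits

nth : A → List A → ℕ → A
nth d []       _       = d
nth d (x ∷ xs) zero    = x
nth d (x ∷ xs) (suc i) = nth d xs i

nth-surjective : ∀ (d : A) {xs x} → x ∈ˡ xs → ∃[ i ] nth d xs i ≡ x
nth-surjective d (here refl) = 0 , refl
nth-surjective d (there p) with i , e ← nth-surjective d p = suc i , e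

evals≡map : ∀ f ρ (ts : Vec (Term k) n) → evals f ρ ts ≡ Vec.map (eval f ρ) ts
evals≡map f ρ []       = refl
evals≡map f ρ (t ∷ ts) = cong (_ ∷_) (evals≡map f ρ ts)

outerVar : Fin n → Term (suc n)
outerVar x = var (suc x)

-- The quantified variable comes first in the environment, but `G ∘𝐟` reads the length from its last
-- argument.
rotatedVars : ∀ n → Vec (Term (suc n)) (suc n)
rotatedVars n = Vec.tabulate outerVar ∷ʳ var zero

evals-rotatedVars : ∀ f x (ρ : Vec ℕ n) → evals f (x ∷ ρ) (rotatedVars n) ≡ ρ ∷ʳ x
evals-rotatedVars {n} f x ρ = begin
  evals f (x ∷ ρ) (rotatedVars n)                  ≡⟨ evals≡map f (x ∷ ρ) (rotatedVars n) ⟩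
  Vec.map ev (rotatedVars n)                       ≡⟨ map-∷ʳ ev (var zero) (Vec.tabulate outerVar) ⟩
  Vec.map ev (Vec.tabulate outerVar) ∷ʳ x          ≡⟨ cong (_∷ʳ x) (tabulate-∘ ev outerVar) ⟨
  Vec.tabulate (Vec.lookup ρ) ∷ʳ x                 ≡⟨ cong (_∷ʳ x) (tabulate∘lookup ρ) ⟩
  ρ ∷ʳ x                                           ∎
  where
  open ≡-Reasoning
  ev = eval f (x ∷ ρ)

eventually-bounded-∀ : ∀ {Q : ℕ → ℕ → Set} → (∀ j → ∃[ N ] (∀ n → n ≥ N → Q j n)) →
  ∀ i → ∃[ N ] (∀ n → n ≥ N → ∀ j → j < i → Q j n)
eventually-bounded-∀ h zero    = 0 , λ _ _ _ ()
eventually-bounded-∀ h (suc i)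
  with N , p ← eventually-bounded-∀ h i | M , q ← h i =
  N ⊔ M , λ { n n≥ j (s≤s j≤i) → case n n≥ (m≤n⇒m<n∨m≡n j≤i) }
  where
  case : ∀ n → n ≥ N ⊔ M → ∀ {j} → j < i ⊎ j ≡ i → _
  case n n≥ (inj₁ j<i)  = p n (≤-trans (m≤m⊔n N M) n≥) _ j<i
  case n n≥ (inj₂ refl) = q n (≤-trans (m≤n⊔m N M) n≥)

ConvergesTo-unique : ∀ {s k l} → s ConvergesTo k → s ConvergesTo l → k ≡ l
ConvergesTo-unique (N , p) (M , q) =
  trans (sym (p (N ⊔ M) (m≤m⊔n N M))) (q (N ⊔ M) (m≤n⊔m N M))

-- Classical closure properties and the complexity of satisfaction

module _ (em : ∀ {ℓ} → ExcludedMiddle ℓ) where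

  indicator : Set → ℕ
  indicator A = if does (em {P = A}) then 1 else 0

  indicator≡1 : {A : Set} → A → indicator A ≡ 1
  indicator≡1 a = cong (if_then 1 else 0) (dec-true em a)

  indicator≡0 : {A : Set} → ¬ A → indicator A ≡ 0
  indicator≡0 ¬a = cong (if_then 1 else 0) (dec-false em ¬a)

  indicator≡1⁻ : {A : Set} → indicator A ≡ 1 → A
  indicator≡1⁻ e = decidable-stable em λ ¬a → contradiction (trans (sym e) (indicator≡0 ¬a)) λ ()

  ∁∁-≐ : (U : Pred Baire 0ℓ) → U ≐ ∁ (∁ U)
  ∁∁-≐ U = (λ u ¬u → ¬u u) , decidable-stable em

  ⋃∁-≐ : (A : ℕ → Pred Baire 0ℓ) → ⋃ ℕ (λ m → ∁ (A m)) ≐ ∁ (λ f → ∀ m → A m f)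
  ⋃∁-≐ A = (λ { (m , ¬a) h → ¬a (h m) }) ,
    λ ¬h → decidable-stable em λ ¬∃ →
      ¬h λ m → decidable-stable em λ ¬a → ¬∃ (m , ¬a)

  ∁∪∁-≐ : (U V : Pred Baire 0ℓ) → ∁ U ∪ ∁ V ≐ ∁ (U ∩ V)
  ∁∪∁-≐ U V = (λ { (inj₁ ¬u) (u , _) → ¬u u ; (inj₂ ¬v) (_ , v) → ¬v v }) , split
    where
    split : ∀ {f} → ¬ (U f × V f) → ¬ U f ⊎ ¬ V f
    split {f} h with em {P = U f}
    ... | yes u = inj₂ λ v → h (u , v)
    ... | no ¬u = inj₁ ¬u

  -- Above level one, intersection distributes over both unions, and `A k ∩ B l` is `𝚷⁰` because the
  -- union of the complements is `𝚺⁰`.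
  𝚺-∩ : ∀ n {U V} → U ∈ 𝚺⁰ (suc n) → V ∈ 𝚺⁰ (suc n) → U ∩ V ∈ 𝚺⁰ (suc n)
  𝚺-∩ zero (isOpen o) (isOpen o′) = isOpen λ { f (u , v) →
    let F , p = o f u ; F′ , p′ = o′ f v
    in F ++ F′ , λ g e → p g (++⁻ˡ F e) , p′ g (++⁻ʳ F e) }
  𝚺-∩ (suc n) (isUnion A π (i , j)) (isUnion B π′ (i′ , j′)) = 𝚺-resp-≐
    ( (λ { (k , l , a , b) → j (k , a) , j′ (l , b) })
    , λ { (u , v) → let k , a = i u ; l , b = i′ v in k , l , a , b })
    (𝚺-⋃ (suc n) λ k → 𝚺-⋃ (suc n) λ l →
      𝚷⇒𝚺-suc n (𝚺-resp-≐ (∁∪∁-≐ (A k) (B l)) (𝚺-∪ n (π k) (π′ l))))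

  mutual
    -- An existential quantifier is a countable union over its witnesses, a universal one dually; at
    -- the bottom the matrix and its negation are both open.
    Models-𝚺 : ∀ {φ : Formula k} ρ → Σ-formula (suc n) φ → Models ρ φ ∈ 𝚺⁰ (suc n)
    Models-𝚺 {n = zero}  ρ (ex (qf q)) = 𝚺-⋃ 0 λ m → isOpen (Models-open (m ∷ ρ) q)
    Models-𝚺 {n = suc n} {∃̇ φ} ρ (ex π) =
      isUnion (λ m → Models (m ∷ ρ) φ) (λ m → Models-𝚷 (m ∷ ρ) π) (id , id)

    Models-𝚷 : ∀ {φ : Formula k} ρ → Π-formula (suc n) φ → Models ρ φ ∈ 𝚷⁰ (suc n)
    Models-𝚷 {n = zero}  ρ (all (qf q)) =
      𝚺-resp-≐ (⋃∁-≐ _) (𝚺-⋃ 0 λ m → isOpen (Models-open (m ∷ ρ) (neg q)))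
    Models-𝚷 {n = suc n} ρ (all σ)      = 𝚺-resp-≐ (⋃∁-≐ _)
      (isUnion _ (λ m → 𝚺-resp-≐ (∁∁-≐ _) (Models-𝚺 (m ∷ ρ) σ)) (id , id))

  Models-Δ₀ : ∀ (φ : Sentence) → Δ-formula 0 φ → Models [] φ ∈ 𝚫⁰ 1
  Models-Δ₀ φ q = isOpen (Models-open [] q) , isOpen (Models-open [] (neg q))

  Models-Δ : ∀ (φ : Sentence) → Δ-formula (suc n) φ → Models [] φ ∈ 𝚫⁰ (suc n)
  Models-Δ φ ((ψ , σ , e) , (χ , π , e′)) =
    𝚺-resp-≐ ((λ {f} → from (e f [])) , λ {f} → to (e f [])) (Models-𝚺 [] σ) ,
    𝚺-resp-≐ ((λ {f} h x → h (to (e′ f []) x)) , λ {f} h x → h (from (e′ f []) x))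
      (Models-𝚷 [] π)

  -- From guessing to the Borel hierarchy

  module _ {n} (φ : ℕ → Sentence) (δ : ∀ i → Models [] (φ i) ∈ 𝚫⁰ (suc n)) where

    -- Recursion on the list, splitting on the truth value of `φ i`; both cases stay `𝚺⁰` because
    -- `φ i` defines a `𝚫⁰` set.
    truthValues-𝚺 : ∀ L (Q : Pred (List Bool) 0ℓ) →
      (λ f → Q (List.map (λ i → truthValue em f (φ i)) L)) ∈ 𝚺⁰ (suc n)
    truthValues-𝚺 []      Q = 𝚺-const n (Q [])
    truthValues-𝚺 (i ∷ L) Q = 𝚺-resp-≐ (join , split)
      (𝚺-∪ n (𝚺-∩ n (proj₁ (δ i)) (truthValues-𝚺 L (Q ∘ (true ∷_))))
             (𝚺-∩ n (proj₂ (δ i)) (truthValues-𝚺 L (Q ∘ (false ∷_)))))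
      where
      join : ∀ {f bs} → (Models [] (φ i) f × Q (true ∷ bs)) ⊎ (¬ Models [] (φ i) f × Q (false ∷ bs)) →
        Q (truthValue em f (φ i) ∷ bs)
      join (inj₁ (m , q)) = subst (λ b → Q (b ∷ _)) (sym (dec-true em m)) q
      join (inj₂ (m , q)) = subst (λ b → Q (b ∷ _)) (sym (dec-false em m)) q

      split : ∀ {f bs} → Q (truthValue em f (φ i) ∷ bs) →
        (Models [] (φ i) f × Q (true ∷ bs)) ⊎ (¬ Models [] (φ i) f × Q (false ∷ bs))
      split {f} q with em {P = ℳ f , [] ⊨ φ i}
      ... | yes m = inj₁ (m , q)
      ... | no ¬m = inj₂ (¬m , q)

    limit-𝚺 : ∀ (G : List Bool → ℕ) v {T} →
      (∀ f → f ∈ T ⇔ ((λ n → G ((λ i → truthValue em f (φ i)) ↾ n)) ConvergesTo v)) →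
      T ∈ 𝚺⁰ (suc (suc n))
    limit-𝚺 G v h = isUnion _
      -- Failure to be settled from `N` on is a union over stages `m` of conditions on finitely many
      -- truth values, so each set in the union over `N` is `𝚷⁰`.
      (λ N → 𝚺-resp-≐ (⋃∁-≐ _) (𝚺-⋃ n λ m →
        truthValues-𝚺 (upTo (suc m)) (λ bs → ¬ (m ≥ N → G bs ≡ v))))
      ((λ {f} → to (h f)) , λ {f} → from (h f))

  -- By uniqueness of limits, limit `1` characterizes `S` and limit `0` its complement. Keeping `n`
  -- apart from `m` lets orders `0` and `1` share a Borel level.
  guessable⇒𝚫 : ∀ {m n S} → (∀ φ → Δ-formula m φ → Models [] φ ∈ 𝚫⁰ (suc n)) →
    Guessable em m S → S ∈ 𝚫⁰ (suc (suc n))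
  guessable⇒𝚫 δ (P , _ , φ , (φ∈ , _) , G , h) =
    limit-𝚺 φ (λ i → δ (φ i) (proj₁ (φ∈ i))) G 1 (λ f → mk⇔ (proj₁ (h f))
      λ c → decidable-stable em λ f∉S →
        contradiction (ConvergesTo-unique c (proj₂ (h f) f∉S)) λ ()) ,
    limit-𝚺 φ (λ i → δ (φ i) (proj₁ (φ∈ i))) G 0 (λ f → mk⇔ (proj₂ (h f))
      λ c f∈S → contradiction (ConvergesTo-unique c (proj₁ (h f) f∈S)) λ ())

  -- From the Borel hierarchy to definability

  mutual
    -- Pushes a negation through the quantifier prefix, since `¬̇ φ` itself is no longer prenex.
    Σ-dual : ∀ {φ : Formula k} → Σ-formula n φ →
      Σ[ ψ ∈ Formula k ] Π-formula n ψ × (∀ f ρ → (ℳ f , ρ ⊨ ψ) ⇔ (¬ (ℳ f , ρ ⊨ φ)))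
    Σ-dual (qf q) = _ , qf (neg q) , λ f ρ → mk⇔ id id
    Σ-dual (ex π) with ψ , σ , e ← Π-dual π = ∀̇ ψ , all σ , λ f ρ → mk⇔
      (λ { h (m , x) → to (e f (m ∷ ρ)) (h m) x })
      (λ h m → from (e f (m ∷ ρ)) λ x → h (m , x))

    Π-dual : ∀ {φ : Formula k} → Π-formula n φ →
      Σ[ ψ ∈ Formula k ] Σ-formula n ψ × (∀ f ρ → (ℳ f , ρ ⊨ ψ) ⇔ (¬ (ℳ f , ρ ⊨ φ)))
    Π-dual (qf q) = _ , qf (neg q) , λ f ρ → mk⇔ id id
    Π-dual {φ = ∀̇ φ} (all σ) with ψ , π , e ← Σ-dual σ = ∃̇ ψ , ex π , λ f ρ → mk⇔
      (λ { (m , x) h → to (e f (m ∷ ρ)) x (h m) })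
      (λ h → let m , ¬x = proj₂ (⋃∁-≐ (λ m g → ℳ g , m ∷ ρ ⊨ φ)) {f} h
             in m , from (e f (m ∷ ρ)) ¬x)

  -- The parameters ρ make the induction work: they are the indices of the
  -- unions already unfolded.
  𝚺-definable : ∀ k {n} (U : Vec ℕ n → Pred Baire 0ℓ) → (∀ ρ → U ρ ∈ 𝚺⁰ (suc k)) →
    Σ[ φ ∈ Formula n ] Σ-formula (suc k) φ × (∀ f ρ → f ∈ U ρ ⇔ (ℳ f , ρ ⊨ φ))
  𝚺-definable zero {n} U σ =
    -- The witness fixes the length of an initial segment whose cylinder lies in `U ρ`; `G` performs
    -- this test with `ρ` among its arguments.
    ∃̇ (app (G ∘𝐟) (rotatedVars n) ≈̇ numeral 1) , ex (qf eq) , λ f ρ → mk⇔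
      (λ f∈U → let x , i = Open⇒Interior (𝚺₁⇒Open (σ ρ)) f f∈U
               in x , trans (eval-G f x ρ) (indicator≡1 i))
      (λ { (x , e) → indicator≡1⁻ (trans (sym (eval-G f x ρ)) e) f x refl })
    where
    G : Vec ℕ n → List ℕ → ℕ
    G ρ s = indicator (Interior (U ρ) s)

    eval-G : ∀ f x ρ → eval f (x ∷ ρ) (app (G ∘𝐟) (rotatedVars n)) ≡ G ρ (f ↾ x)
    eval-G f x ρ = cong₂ (λ ms m → G ms (f ↾ m))
      (trans (cong Vec.init (evals-rotatedVars f x ρ)) (init-∷ʳ x ρ))
      (trans (cong Vec.last (evals-rotatedVars f x ρ)) (last-∷ʳ x ρ))
  𝚺-definable (suc k) U σ
    -- The complement of the `i`-th piece is `𝚺⁰`, so the recursion defines it with `i` as a further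
    -- parameter; dualizing then defines the piece by a Π formula.
    with φ , s , e ← 𝚺-definable k (λ { (i ∷ ρ) → ∁ (proj₁ (𝚺⇒⋃ (σ ρ)) i) })
                                   (λ { (i ∷ ρ) → proj₁ (proj₂ (𝚺⇒⋃ (σ ρ))) i })
    with ψ , π , d ← Σ-dual s =
    ∃̇ ψ , ex π , λ f ρ → mk⇔
      (λ f∈U → let i , a = proj₁ (proj₂ (proj₂ (𝚺⇒⋃ (σ ρ)))) f∈U
               in i , from (d f (i ∷ ρ)) λ x → from (e f (i ∷ ρ)) x a)
      (λ { (i , x) → proj₂ (proj₂ (proj₂ (𝚺⇒⋃ (σ ρ))))
             (i , decidable-stable em λ ¬a → to (d f (i ∷ ρ)) x (to (e f (i ∷ ρ)) ¬a)) })

  -- One level up both `C` and `∁ C` are `𝚺⁰`, hence Σ-definable; the dual of the formula for `∁ C`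
  -- is the Π form of `C`.
  𝚷-Δ-definable : ∀ n {C} → C ∈ 𝚷⁰ (suc n) →
    Σ[ φ ∈ Sentence ] Δ-formula (suc (suc n)) φ × (∀ f → f ∈ C ⇔ (ℳ f , [] ⊨ φ))
  𝚷-Δ-definable n {C} π
    with φ , s , e ← 𝚺-definable (suc n) (λ (_ : Vec ℕ 0) → C) (λ _ → 𝚷⇒𝚺-suc n π)
       | χ , t , d ← 𝚺-definable (suc n) (λ (_ : Vec ℕ 0) → ∁ C) (λ _ → 𝚺-suc n π)
    with ψ , p , c ← Σ-dual t =
    φ ,
    ( (φ , s , λ f ρ → mk⇔ id id)
    , (ψ , p , λ f ρ → mk⇔
        (λ x → from (c f ρ) λ y → from (d f ρ) y (from (e f ρ) x))
        (λ x → to (e f ρ) (decidable-stable em λ ¬a → to (c f ρ) x (to (d f ρ) ¬a))))) ,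
    λ f → e f []

  IsUnionOfΔ : ℕ → Pred Baire 0ℓ → Set₁
  IsUnionOfΔ m U = Σ[ ψ ∈ (ℕ → Sentence) ] (∀ j → Δ-formula m (ψ j)) ×
    (∀ f → f ∈ U ⇔ (∃[ j ] (ℳ f , [] ⊨ ψ j)))

  -- The length is a numeral, so the union over `j` stays outside the formula and costs no
  -- quantifier. Arbitrary `k` permits use under a vacuous quantifier.
  cylinderFormula : Pred Baire 0ℓ → ℕ → Formula k
  cylinderFormula U j =
    app ((λ _ s → indicator (Interior U s)) ∘𝐟) (numeral j ∷ []) ≈̇ numeral 1

  cylinderFormula-union : ∀ {U} → Open U → ∀ f →
    f ∈ U ⇔ (∃[ j ] (ℳ f , [] ⊨ cylinderFormula U j))
  cylinderFormula-union o f = mk⇔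
    (λ f∈U → map₂ indicator≡1 (Open⇒Interior o f f∈U))
    (λ { (j , e) → indicator≡1⁻ e f j refl })

  𝚺₁⇒⋃Δ₀ : ∀ {U} → U ∈ 𝚺⁰ 1 → IsUnionOfΔ 0 U
  𝚺₁⇒⋃Δ₀ {U} σ = cylinderFormula U , (λ j → eq) , cylinderFormula-union (𝚺₁⇒Open σ)

  𝚺⇒⋃Δ : ∀ n {U} → U ∈ 𝚺⁰ (suc n) → IsUnionOfΔ (suc n) U
  𝚺⇒⋃Δ zero {U} σ = cylinderFormula U ,
    -- Vacuous quantifiers give the quantifier-free sentence its Σ and Π forms.
    (λ j → ( (∃̇ cylinderFormula U j , ex (qf eq) , λ f ρ → mk⇔ (λ e → 0 , e) proj₂)
           , (∀̇ cylinderFormula U j , all (qf eq) , λ f ρ → mk⇔ (λ e _ → e) λ e → e 0))) ,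
    cylinderFormula-union (𝚺₁⇒Open σ)
  𝚺⇒⋃Δ (suc n) (isUnion A π (i , j)) =
    (λ l → proj₁ (𝚷-Δ-definable n (π l))) ,
    (λ l → proj₁ (proj₂ (𝚷-Δ-definable n (π l)))) ,
    λ f → mk⇔
      (λ u → map₂ (λ {l} → to (proj₂ (proj₂ (𝚷-Δ-definable n (π l))) f)) (i u))
      (λ { (l , x) → j (l , from (proj₂ (proj₂ (𝚷-Δ-definable n (π l))) f) x) })

  -- From definability to guessing

  treeAt : ℕ → Tree
  treeAt n with em {P = ∃[ t ] encode t ≡ n}
  ... | yes (t , _) = t
  ... | no  _       = leaf 0

  treeAt-encode : ∀ t → treeAt (encode t) ≡ t
  treeAt-encode t with em {P = ∃[ u ] encode u ≡ encode t}
  ... | yes (u , e) = encode-injective u t e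
  ... | no ¬∃       = contradiction (t , refl) ¬∃

  -- Excluded middle picks an index for each point of the range; `e` inverts this choice, so it is
  -- injective there.
  range-countable : {A : Set a} (e : ℕ → A) → Countable (λ x → ∃[ i ] e i ≡ x)
  range-countable {A = A} e = c , λ p q cx≡cy →
    trans (sym (e-c p)) (trans (cong e cx≡cy) (e-c q))
    where
    c : A → ℕ
    c x with em {P = ∃[ i ] e i ≡ x}
    ... | yes (i , _) = i
    ... | no  _       = 0

    e-c : ∀ {x} → ∃[ i ] e i ≡ x → e (c x) ≡ x
    e-c {x} p with em {P = ∃[ i ] e i ≡ x}
    ... | yes (_ , q) = q
    ... | no ¬p       = contradiction p ¬p

  -- Entries outside `P` are overwritten by `d`, harmless because a listing may repeat.
  filter-Lists : {A : Set a} (e : ℕ → A) (P : Pred A ℓ) (d : A) → d ∈ P →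
    (∀ x → x ∈ P → ∃[ n ] e n ≡ x) → Σ[ φ ∈ (ℕ → A) ] φ Lists P
  filter-Lists {A = A} e P d d∈P surj = φ , φ∈P , λ x x∈P →
    let n , p = surj x x∈P in n , trans (φ≡e n (subst P (sym p) x∈P)) p
    where
    φ : ℕ → A
    φ n with em {P = P (e n)}
    ... | yes _ = e n
    ... | no  _ = d

    φ∈P : ∀ n → P (φ n)
    φ∈P n with em {P = P (e n)}
    ... | yes p = p
    ... | no  _ = d∈P

    φ≡e : ∀ n → P (e n) → φ n ≡ e n
    φ≡e n p with em {P = P (e n)}
    ... | yes _ = refl
    ... | no ¬p = contradiction p ¬p

  -- The symbols of all the `θ i` form a countable vocabulary; every formula over it is decoded from
  -- some tree, and filtering leaves the required sentences.
  Δ-listing : ∀ m (θ : ℕ → Sentence) → (∀ i → Δ-formula m (θ i)) →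
    Σ[ P ∈ Pred Symbol 1ℓ ] Countable P ×
    (Σ[ φ ∈ (ℕ → Sentence) ]
      φ Lists (λ ψ → Δ-formula m ψ × FormulaOver P ψ) × (∀ i → ∃[ n ] φ n ≡ θ i))
  Δ-listing m θ δ =
    Range , range-countable e , φ , lists , λ i → proj₂ lists (θ i) (δ i , θ-over i)
    where
    e : ℕ → Symbol
    -- `p` codes a sentence and a position in its symbol list; past the end stands the filler
    -- `const 0`.
    e p = nth (inj₁ (0 , const 0)) (symbols (θ (proj₁ (unpair p)))) (proj₂ (unpair p))

    open Decoding e

    θ-over : ∀ i → FormulaOver Range (θ i)
    θ-over i = formulaOver (θ i) λ {s} s∈ →
      let j , q = nth-surjective _ s∈
      in pair i j , trans (cong (λ p → nth _ (symbols (θ (proj₁ p))) (proj₂ p)) (unpair-pair i j)) q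

    listing : Σ[ φ ∈ (ℕ → Sentence) ]
      φ Lists (λ ψ → Δ-formula m ψ × FormulaOver Range ψ)
    listing = filter-Lists (formula ∘ treeAt) _ (θ 0) (δ 0 , θ-over 0) λ ψ (_ , o) →
      let t , q = formula-surjective o
      in encode t , trans (cong formula (treeAt-encode t)) q

    φ = proj₁ listing
    lists = proj₂ listing

  module _ (φ : ℕ → Sentence) where

    truthValues : Baire → ℕ → Bool
    truthValues f i = truthValue em f (φ i)

    -- Equivalently, `∁ U` is a union of sets defined by listed sentences.
    Refutable : Pred Baire 0ℓ → Set
    Refutable U = ∀ f → f ∉ U →
      ∃[ N ] ((ℳ f , [] ⊨ φ N) × (∀ g → ℳ g , [] ⊨ φ N → g ∉ U))

    Consistent : Pred Baire 0ℓ → List Bool → Set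
    Consistent U bs = ∃[ g ] ∃[ n ] (g ∈ U × truthValues g ↾ n ≡ bs)

    -- From stage `N` on the list records that the refuting sentence `φ N` is true, so no member of
    -- `U` can share it.
    eventually-inconsistent : ∀ {U} → Refutable U → ∀ f → f ∉ U →
      ∃[ N ] (∀ n → n ≥ N → ¬ Consistent U (truthValues f ↾ n))
    eventually-inconsistent r f f∉U with N , f⊨ , h ← r f f∉U =
      N , λ { n n≥N (g , i , g∈U , e) → h g
        (decidable-stable em λ g⊭ → contradiction
          (trans (sym (dec-false em g⊭))
            (trans (↾-agree {g = truthValues g} {truthValues f} {i} {n} e n≥N) (dec-true em f⊨)))
          λ ())
        g∈U }

    -- The first surviving set in the list A₀, B₀, A₁, B₁, … is an A.
    GuessIn : (A B : ℕ → Pred Baire 0ℓ) → List Bool → Set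
    GuessIn A B bs =
      ∃[ i ] (Consistent (A i) bs × (∀ j → j < i → ¬ Consistent (B j) bs))

    module _ {S : Pred Baire 0ℓ} {A B} (S≐⋃A : S ≐ ⋃ ℕ A) (∁S≐⋃B : ∁ S ≐ ⋃ ℕ B)
      (rA : ∀ i → Refutable (A i)) (rB : ∀ i → Refutable (B i)) where

      -- `f` itself keeps `A i` consistent forever, while the finitely many `B j` preceding it are
      -- all refuted eventually.
      guess-in : ∀ f → f ∈ S →
        (λ n → indicator (GuessIn A B (truthValues f ↾ n))) ConvergesTo 1
      guess-in f f∈S
        with i , f∈A ← proj₁ S≐⋃A f∈S
        with N , h ← eventually-bounded-∀ (λ j → eventually-inconsistent (rB j) f
                       λ f∈B → proj₂ ∁S≐⋃B (j , f∈B) f∈S) i =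
        N , λ n n≥N → indicator≡1 (i , (f , n , f∈A , refl) , h n n≥N)

      -- `A j` precedes `B j`, so the sets to be refuted are those up to and including `A j`, whence
      -- `suc j`; any later `A i` is blocked by `B j`, which `f` keeps consistent.
      guess-out : ∀ f → f ∉ S →
        (λ n → indicator (GuessIn A B (truthValues f ↾ n))) ConvergesTo 0
      guess-out f f∉S
        with j , f∈B ← proj₁ ∁S≐⋃B f∉S
        with N , h ← eventually-bounded-∀ (λ i → eventually-inconsistent (rA i) f
                       λ f∈A → f∉S (proj₂ S≐⋃A (i , f∈A))) (suc j) =
        N , λ n n≥N → indicator≡0 λ { (i , cA , ¬cB) → case n n≥N i cA ¬cB (≤-<-connex i j) }
        where
        case : ∀ n → n ≥ N → ∀ i → Consistent (A i) (truthValues f ↾ n) →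
          (∀ j → j < i → ¬ Consistent (B j) (truthValues f ↾ n)) → ¬ (i ≤ j ⊎ j < i)
        case n n≥N i cA ¬cB (inj₁ i≤j) = h n n≥N i (s≤s i≤j) cA
        case n n≥N i cA ¬cB (inj₂ j<i) = ¬cB j j<i (f , n , f∈B , refl)

  𝚫⇒guessable : ∀ {m n S} → (∀ {U} → U ∈ 𝚺⁰ (suc n) → IsUnionOfΔ m U) →
    S ∈ 𝚫⁰ (suc (suc n)) → Guessable em m S
  𝚫⇒guessable {m} {S = S} δ (isUnion A πA S≐⋃A , isUnion B πB ∁S≐⋃B) =
    P , countable , φ , lists ,
    (λ bs → indicator (GuessIn φ A B bs)) ,
    λ f → guess-in φ S≐⋃A ∁S≐⋃B (refutable 0) (refutable 1) f ,
          guess-out φ S≐⋃A ∁S≐⋃B (refutable 0) (refutable 1) f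
    where
    -- Merges both families so that one listing contains the refuting sentences for each.
    D : ℕ → ℕ → Pred Baire 0ℓ
    D zero    = A
    D (suc _) = B

    ∁D : ∀ c i → IsUnionOfΔ m (∁ (D c i))
    ∁D zero    i = δ (πA i)
    ∁D (suc _) i = δ (πB i)

    ψ : (ℕ × ℕ) × ℕ → Sentence
    ψ ((c , i) , j) = proj₁ (∁D c i) j

    decodeIndex : ℕ → (ℕ × ℕ) × ℕ
    decodeIndex p = map₁ unpair (unpair p)

    decodeIndex-pair : ∀ c i j → decodeIndex (pair (pair c i) j) ≡ ((c , i) , j)
    decodeIndex-pair c i j =
      trans (cong (map₁ unpair) (unpair-pair (pair c i) j)) (cong (_, j) (unpair-pair c i))

    Listing : Σ[ P ∈ Pred Symbol 1ℓ ] Countable P ×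
      (Σ[ φ ∈ (ℕ → Sentence) ]
        φ Lists (λ χ → Δ-formula m χ × FormulaOver P χ) × (∀ p → ∃[ n ] φ n ≡ ψ (decodeIndex p)))
    Listing = Δ-listing m (ψ ∘ decodeIndex) λ p →
      let ((c , i) , j) = decodeIndex p in proj₁ (proj₂ (∁D c i)) j

    P = proj₁ Listing
    countable = proj₁ (proj₂ Listing)
    φ = proj₁ (proj₂ (proj₂ Listing))
    lists = proj₁ (proj₂ (proj₂ (proj₂ Listing)))

    occurs : ∀ c i j → ∃[ n ] φ n ≡ ψ ((c , i) , j)
    occurs c i j = map₂ (λ e → trans e (cong ψ (decodeIndex-pair c i j)))
      (proj₂ (proj₂ (proj₂ (proj₂ Listing))) (pair (pair c i) j))

    refutable : ∀ c i → Refutable φ (D c i)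
    refutable c i f f∉D
      with j , f⊨ψ ← to (proj₂ (proj₂ (∁D c i)) f) f∉D
      with N , e ← occurs c i j =
      N , subst (λ χ → ℳ f , [] ⊨ χ) (sym e) f⊨ψ ,
      λ g g⊨φ → from (proj₂ (proj₂ (∁D c i)) g) (j , subst (λ χ → ℳ g , [] ⊨ χ) e g⊨φ)

mainTheorem1 : (em : ∀ {ℓ} → ExcludedMiddle ℓ) (S : Pred Baire 0ℓ) →
    (Guessable em 0 S ⇔ S ∈ 𝚫⁰ 2) ×
    (∀ (m : ℕ) → m > 0 → Guessable em m S ⇔ S ∈ 𝚫⁰ (suc m))
mainTheorem1 em S =
  -- Quantifier-free sentences already define `𝚫⁰ 1` sets and suffice to test cylinders, so order
  -- `0` reaches the same class as order `1`.
  mk⇔ (guessable⇒𝚫 em (Models-Δ₀ em)) (𝚫⇒guessable em (𝚺₁⇒⋃Δ₀ em)) ,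
  λ { (suc n) _ → mk⇔ (guessable⇒𝚫 em (Models-Δ em)) (𝚫⇒guessable em (𝚺⇒⋃Δ em n)) }
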